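{- Let $p$ be a prime greater than $3$ and let $x$ be an indeterminate. Then $$\sum_{k=0}^{[p/3]}\frac{(3k)!}{27^k\,k!^3}\big(x^k-(-1)^{[p/3]}(1-x)^k\big)\equiv0\pmod p.$$
   Context: $[y]$ is the greatest integer not exceeding $y$. The congruence is coefficientwise for polynomials with rational coefficients having denominators prime to $p$. -}

module Defs where

open import Level using (0ℓ)
open import Algebra.Bundles.Raw using (RawRing)
import Algebra.Definitions.RawSemiring as RawSemiringDefs
open import Data.Fin.Base using (toℕ)
open import Data.Integer.Base using (+_)
open import Data.List.Base using (List; []; _∷_; map)
open import Data.Nat.Base using (ℕ; zero; suc; NonZero; _!; _*_; _^_)
open import Data.Nat.Coprimality using (Coprime)
open import Data.Nat.Properties using (m^n≢0; m*n≢0; _!≢0)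
open import Data.Product.Base using (Σ-syntax; _×_)
open import Data.Rational.Base as ℚ using (ℚ; 0ℚ; 1ℚ; _/_; ↧ₙ_)
open import Relation.Binary.PropositionalEquality using (_≡_)

infix  4 _≈ᴾ_
infixl 6 _+ᴾ_ _-ᴾ_
infixl 7 _*ᴾ_
infix  8 -ᴾ_
infixr 9 _^ᴾ_

-- A polynomial in ℚ[x] is given by its list of coefficients, constant term
-- first.  Trailing zeros are allowed, so equality is _≈ᴾ_ and not _≡_.
Poly : Set
Poly = List ℚ

coeff : Poly → ℕ → ℚ
coeff []      _       = 0ℚ
coeff (a ∷ f) zero    = a
coeff (a ∷ f) (suc n) = coeff f n

_≈ᴾ_ : Poly → Poly → Set
f ≈ᴾ g = ∀ n → coeff f n ≡ coeff g n

C : ℚ → Poly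
C a = a ∷ []

0ᴾ 1ᴾ X : Poly
0ᴾ = []
1ᴾ = C 1ℚ
X  = 0ℚ ∷ 1ℚ ∷ []

_+ᴾ_ : Poly → Poly → Poly
[]      +ᴾ g       = g
(a ∷ f) +ᴾ []      = a ∷ f
(a ∷ f) +ᴾ (b ∷ g) = (a ℚ.+ b) ∷ (f +ᴾ g)

-ᴾ_ : Poly → Poly
-ᴾ f = map ℚ.-_ f

_-ᴾ_ : Poly → Poly → Poly
f -ᴾ g = f +ᴾ (-ᴾ g)

_*ᴾ_ : Poly → Poly → Poly
[]      *ᴾ g = []
(a ∷ f) *ᴾ g = map (a ℚ.*_) g +ᴾ (0ℚ ∷ (f *ᴾ g))

polyRawRing : RawRing 0ℓ 0ℓ
polyRawRing = record
  { Carrier = Poly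
  ; _≈_     = _≈ᴾ_
  ; _+_     = _+ᴾ_
  ; _*_     = _*ᴾ_
  ; -_      = -ᴾ_
  ; 0#      = 0ᴾ
  ; 1#      = 1ᴾ
  }

private
  module PolyDefs = RawSemiringDefs (RawRing.rawSemiring polyRawRing)

_^ᴾ_ : Poly → ℕ → Poly
_^ᴾ_ = PolyDefs._^_

∑≤ : ℕ → (ℕ → Poly) → Poly
∑≤ n f = PolyDefs.sum {suc n} (λ i → f (toℕ i))

syntax ∑≤ n (λ k → t) = ∑[ k ≤ n ] t

w : ℕ → ℚ
w k = + ((3 * k) !) / (27 ^ k * (k !) ^ 3)
  where
  instance
    27^k≢0 : NonZero (27 ^ k)
    27^k≢0 = m^n≢0 27 k
    k!^3≢0 : NonZero ((k !) ^ 3)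
    k!^3≢0 = m^n≢0 (k !) 3 {{k !≢0}}
    denominator≢0 : NonZero (27 ^ k * (k !) ^ 3)
    denominator≢0 = m*n≢0 (27 ^ k) ((k !) ^ 3)

-- ↧ₙ is the denominator in lowest terms.
Integral : ℕ → ℚ → Set
Integral p q = Coprime (↧ₙ q) p

-- Congruence modulo p in the ring of rationals with denominator prime to p.
-- Membership of both sides in that ring is part of the relation.
_≡_[modℚ_] : ℚ → ℚ → ℕ → Set
q ≡ r [modℚ p ] =
  Integral p q × Integral p r ×
  (Σ[ s ∈ ℚ ] (Integral p s × q ℚ.- r ≡ (+ p / 1) ℚ.* s))

_≡_[modᴾ_] : Poly → Poly → ℕ → Set
f ≡ g [modᴾ p ] = ∀ n → coeff f n ≡ coeff g n [modℚ p ]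

infix 4 _≡_[modℚ_] _≡_[modᴾ_]

{-# OPTIONS --safe #-}

-- Put n = [p/3].  Since p divides (3n + 1)(3n + 2), comparing successive ratios
-- gives (3k)!/(27^k k!³) ≡ (−1)^k C(n,k) C(n+k,n) (mod p) for k ≤ n, so the sum
-- of the w k x^k is the shifted Legendre polynomial L_n modulo p, and the claim
-- becomes L_n(x) = (−1)^n L_n(1 − x).  This holds in every commutative ring: with
-- E the shift of m, L_n(x) is the value at m = n of (1 − xE)^n applied to
-- m ↦ C(m,n), and Pascal's rule shows by induction on a that replacing x by 1 − x
-- in (1 − xE)^a C(m,r) amounts to the sign (−1)^a and r ↦ a + m − r.

module Submission where

open import Algebra.Bundles using (CommutativeRing)
import Algebra.Properties.Ring as RingProperties
import Algebra.Properties.Semiring.Exp as Exp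
import Algebra.Properties.Semiring.Mult as Mult
import Algebra.Properties.Semiring.Sum as Sum
import Algebra.Solver.Ring.NaturalCoefficients.Default as NatSolver
open import Algebra.Structures using (IsCommutativeRing)
open import Data.Fin.Base using (toℕ)
open import Data.Integer.Base as ℤ using (ℤ; +_; 1ℤ; -1ℤ)
import Data.Integer.Divisibility.Signed as ℤ
import Data.Integer.Properties as ℤ
open import Data.Integer.Tactic.RingSolver using () renaming (solve-∀ to solveℤ-∀)
open import Data.List.Base using ([]; _∷_; map)
open import Data.Nat.Base as ℕ using (ℕ; zero; suc; _<_; _≤_; _/_; s≤s; z≤n; NonZero)
open import Data.Nat.Combinatorics using
  ( nCn≡1; nCk≡nC[n∸k]; nCk≡n!/k![n-k]!; k>n⇒nCk≡0
  ; nCk+nC[k+1]≡[n+1]C[k+1]; k![n∸k]!∣n!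
  ) renaming (_C_ to _choose_)
open import Data.Nat.Coprimality as Coprime using (Coprime; coprime-divisor; prime⇒coprime)
open import Data.Nat.Divisibility using (_∣_; divides; ∣-trans; ∣-refl)
open import Data.Nat.DivMod using (_%_; m/n*n≡m; m≡m%n+[m/n]*n; m%n<n; m/n<m)
open import Data.Nat.Primality using (Prime)
import Data.Nat.Properties as ℕ
open import Data.Nat.Tactic.RingSolver using () renaming (solve-∀ to solveℕ-∀)
open import Data.Product.Base using (_×_; _,_; Σ-syntax)
open import Data.Rational.Base as ℚ using (ℚ; 0ℚ; 1ℚ; ↧ₙ_)
import Data.Rational.Properties as ℚ
open import Data.Rational.Solver using (module +-*-Solver)
open import Data.Rational.Unnormalised.Base as ℚᵘ using (mkℚᵘ; *≡*)
import Data.Rational.Unnormalised.Properties as ℚᵘ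
open import Level using (0ℓ)
open import Relation.Binary.PropositionalEquality as ≡ using (_≡_)
import Relation.Binary.Reasoning.Setoid as SetoidReasoning
open import Relation.Binary.Structures using (IsEquivalence)
open import Relation.Nullary.Negation using (contradiction)

open import Defs

-- The Legendre coefficients arise from rising factorials: (3k)!/(27^k k!³) = (1/3)_k (2/3)_k / k!²,
-- while (-1)^k C(n,k) C(n+k,n) = (-n)_k (n+1)_k / k!², and modulo p the pair -n, n + 1 is the pair
-- 1/3, 2/3 in some order. The operator is read off from C(n+k,n), the value at m = n of the k-th
-- shift of m ↦ C(m,n). In L_n the one number n is exponent, evaluation point and lower index at
-- once, which leaves no room for induction; a, m and r separate the three roles. No quotient ring
-- modulo p is formed. The reflection is an exact identity in ℚ[x] with integer coefficients, so a
-- sum equal to zero is subtracted from the given one, and each coefficient left over is p times a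
-- p-integral rational.

module ShiftedLegendre {ℓ₁ ℓ₂} (R : CommutativeRing ℓ₁ ℓ₂) where

  open CommutativeRing R
  open Exp semiring using (_^_)
  open Mult semiring using (×-congʳ; ×-homo-+; ×-homo-1; ×-comm-*) renaming (_×_ to _·_)
  open RingProperties ring using (-1*x≈-x; -‿+-comm; -‿distribˡ-*; -‿involutive)
  open SetoidReasoning setoid
  open NatSolver commutativeSemiring using (solve; _:+_; _:*_; _:=_)

  -- Reflection of the shifted Legendre polynomials over a commutative ring.

  sum≤ : ℕ → (ℕ → Carrier) → Carrier
  sum≤ n f = Sum.sum semiring {suc n} (λ i → f (toℕ i))

  sum≤-cong : ∀ n {f g} → (∀ k → f k ≈ g k) → sum≤ n f ≈ sum≤ n g
  sum≤-cong n f≈g = Sum.sum-cong-≋ semiring {suc n} (λ i → f≈g (toℕ i))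

  sum≤-+ : ∀ n f g → sum≤ n (λ k → f k + g k) ≈ sum≤ n f + sum≤ n g
  sum≤-+ n f g = Sum.∑-distrib-+ semiring {suc n} (λ i → f (toℕ i)) (λ i → g (toℕ i))

  sum≤-*ˡ : ∀ n a f → a * sum≤ n f ≈ sum≤ n (λ k → a * f k)
  sum≤-*ˡ n a f = Sum.*-distribˡ-sum semiring {suc n} a (λ i → f (toℕ i))

  sum≤-last : ∀ n f → sum≤ (suc n) f ≈ sum≤ n f + f (suc n)
  sum≤-last zero    f = sym (trans (+-congʳ (+-identityʳ _)) (+-congˡ (sym (+-identityʳ _))))
  sum≤-last (suc n) f = trans (+-congˡ (sum≤-last n (λ k → f (suc k)))) (sym (+-assoc _ _ _))

  -- With h(m) = m choose r and E the shift of m, this is (1 + yE)^a h at m.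
  P : Carrier → ℕ → ℕ → ℕ → Carrier
  P y zero    m r = (m choose r) · 1#
  P y (suc a) m r = P y a m r + y * P y a (suc m) r

  -- Pascal's rule is linear in the binomials and holds at every m, so each application of 1 + yE
  -- preserves it.
  P-pascal : ∀ y a m r → P y a (suc m) (suc r) ≈ P y a m r + P y a m (suc r)
  P-pascal y zero m r = begin
    (suc m choose suc r) · 1#                 ≡⟨ ≡.cong (_· 1#) (nCk+nC[k+1]≡[n+1]C[k+1] m r) ⟨
    (m choose r ℕ.+ m choose suc r) · 1#           ≈⟨ ×-homo-+ 1# (m choose r) (m choose suc r) ⟩
    (m choose r) · 1# + (m choose suc r) · 1#      ∎
  P-pascal y (suc a) m r = begin
    P y a (suc m) (suc r) + y * P y a (suc (suc m)) (suc r)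
      ≈⟨ +-cong (P-pascal y a m r) (*-congˡ (P-pascal y a (suc m) r)) ⟩
    (P y a m r + P y a m (suc r)) + y * (P y a (suc m) r + P y a (suc m) (suc r))
      ≈⟨ solve 5 (λ y p q u v → (p :+ q) :+ y :* (u :+ v) := (p :+ y :* u) :+ (q :+ y :* v)) refl
           y (P y a m r) (P y a m (suc r)) (P y a (suc m) r) (P y a (suc m) (suc r)) ⟩
    P y (suc a) m r + P y (suc a) m (suc r)
      ∎

  -- C(m,0) = 1 is constant in m. This replaces Pascal's rule at lower index 0.
  P-zero : ∀ y a m → P y a (suc m) 0 ≈ P y a m 0
  P-zero y zero    m = refl
  P-zero y (suc a) m = +-cong (P-zero y a m) (*-congˡ (P-zero y a (suc m)))

  -- Only the values of C(·,r) at m, ..., m + a enter, and all of them are 0.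
  P-vanish : ∀ y a m r → a ℕ.+ m < r → P y a m r ≈ 0#
  P-vanish y zero    m r m<r   = reflexive (≡.cong (_· 1#) (k>n⇒nCk≡0 m<r))
  P-vanish y (suc a) m r a+m<r = begin
    P y a m r + y * P y a (suc m) r
      ≈⟨ +-cong (P-vanish y a m r (ℕ.<-trans (ℕ.n<1+n _) a+m<r))
                (*-congˡ (P-vanish y a (suc m) r (≡.subst (_< r) (≡.sym (ℕ.+-suc a m)) a+m<r))) ⟩
    0# + y * 0#
      ≈⟨ trans (+-identityˡ _) (zeroʳ y) ⟩
    0#
      ∎

  -- With y = -x, the map y ↦ -(1 + y) is x ↦ 1 - x; the equation for r + s replaces a truncated
  -- subtraction. For a = 0 this is the symmetry of binomials. In the step the two summands reflect
  -- to index s - 1 at m and index s at m + 1; Pascal's rule splits the latter, and the parts of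
  -- index s - 1 cancel.
  P-reflect : ∀ y y′ → y′ ≈ - 1# * (1# + y) →
    ∀ a m r s → r ℕ.+ s ≡ a ℕ.+ m → P y′ a m r ≈ (- 1#) ^ a * P y a m s
  P-reflect y y′ y′≈ zero m r s r+s≡m = begin
    (m choose r) · 1#         ≡⟨ ≡.cong (_· 1#) mCr≡mCs ⟩
    (m choose s) · 1#         ≈⟨ *-identityˡ _ ⟨
    1# * (m choose s) · 1#    ∎
    where
    mCr≡mCs : m choose r ≡ m choose s
    mCr≡mCs = ≡.subst (λ m → m choose r ≡ m choose s) r+s≡m
      (≡.trans (nCk≡nC[n∸k] (ℕ.m≤m+n r s)) (≡.cong ((r ℕ.+ s) choose_) (ℕ.m+n∸m≡n r s)))
  P-reflect y y′ y′≈ (suc a) m r s r+s≡ = begin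
    P y′ a m r + y′ * P y′ a (suc m) r
      ≈⟨ +-cong (P-below r s r+s≡) (*-cong y′≈ (P-reflect y y′ y′≈ a (suc m) r s r+s≡a+[1+m])) ⟩
    σ * P₋ s + e * (1# + y) * (σ * B)
      ≈⟨ +-congˡ (solve 5 (λ e i y σ b → e :* (i :+ y) :* (σ :* b) := i :* e :* (σ :* b) :+ e :* σ :* (y :* b)) refl e 1# y σ B) ⟩
    σ * P₋ s + (1# * e * (σ * B) + e * σ * (y * B))
      ≈⟨ +-congˡ (+-congʳ (*-cong (*-identityˡ e) (*-congˡ (P-split s)))) ⟩
    σ * P₋ s + (e * (σ * (P₋ s + A)) + e * σ * (y * B))
      ≈⟨ solve 5 (λ e σ p a b → σ :* p :+ (e :* (σ :* (p :+ a)) :+ e :* σ :* b)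
                             := (σ :* p :+ e :* (σ :* p)) :+ e :* σ :* (a :+ b)) refl e σ (P₋ s) A (y * B) ⟩
    (σ * P₋ s + e * (σ * P₋ s)) + e * σ * (A + y * B)
      -- The semiring solver treats `e` as an atom; that it is -1 enters here, to cancel the two
      -- parts of index s - 1.
      ≈⟨ +-congʳ (trans (+-congˡ (-1*x≈-x _)) (-‿inverseʳ _)) ⟩
    0# + e * σ * (A + y * B)
      ≈⟨ +-identityˡ _ ⟩
    e * σ * (A + y * B)
      ∎
    where
    e = - 1#
    σ = e ^ a
    A = P y a m s
    B = P y a (suc m) s

    -- P y a m (s - 1), read as 0 at s = 0.
    P₋ : ℕ → Carrier
    P₋ zero    = 0#
    P₋ (suc s) = P y a m s

    P-split : ∀ s → P y a (suc m) s ≈ P₋ s + P y a m s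
    P-split zero    = trans (P-zero y a m) (sym (+-identityˡ _))
    P-split (suc s) = P-pascal y a m s

    r+s≡a+[1+m] : r ℕ.+ s ≡ a ℕ.+ suc m
    r+s≡a+[1+m] = ≡.trans r+s≡ (≡.sym (ℕ.+-suc a m))

    P-below : ∀ r s → r ℕ.+ s ≡ suc (a ℕ.+ m) → P y′ a m r ≈ σ * P₋ s
    -- s = 0 forces r = a + m + 1, just past the last index at which `P y′ a m r` can be nonzero;
    -- this justifies the value 0 of `P₋ zero`.
    P-below r zero    r+0≡ = trans
      (P-vanish y′ a m r (ℕ.≤-reflexive (≡.trans (≡.sym r+0≡) (ℕ.+-identityʳ r))))
      (sym (zeroʳ σ))
    P-below r (suc s) r+s≡ =
      P-reflect y y′ y′≈ a m r s (ℕ.suc-injective (≡.trans (≡.sym (ℕ.+-suc r s)) r+s≡))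

  -- The coefficient form of (1 + E)^(a+1) = (1 + E)^a + (1 + E)^a E, with E the shift of `h`.
  binomialSum-step : ∀ a (h : ℕ → Carrier) →
    sum≤ (suc a) (λ k → (suc a choose k) · h k) ≈
    sum≤ a (λ k → (a choose k) · h k) + sum≤ a (λ k → (a choose k) · h (suc k))
  binomialSum-step a h = begin
    1 · h 0 + sum≤ a (λ k → (suc a choose suc k) · h (suc k))
      ≈⟨ +-congˡ (sum≤-cong a λ k → trans
           (reflexive (≡.cong (_· h (suc k)) (≡.sym (nCk+nC[k+1]≡[n+1]C[k+1] a k))))
           (×-homo-+ (h (suc k)) (a choose k) (a choose suc k))) ⟩
    1 · h 0 + sum≤ a (λ k → (a choose k) · h (suc k) + (a choose suc k) · h (suc k))
      ≈⟨ +-congˡ (sum≤-+ a (λ k → (a choose k) · h (suc k)) (λ k → (a choose suc k) · h (suc k))) ⟩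
    1 · h 0 + (sum≤ a (λ k → (a choose k) · h (suc k)) + sum≤ a (λ k → (a choose suc k) · h (suc k)))
      ≈⟨ solve 3 (λ x y z → x :+ (y :+ z) := (x :+ z) :+ y) refl _ _ _ ⟩
    sum≤ (suc a) (λ k → (a choose k) · h k) + sum≤ a (λ k → (a choose k) · h (suc k))
      -- The additional top term of the longer sum has coefficient C(a,a+1) = 0.
      ≈⟨ +-congʳ (sum≤-last a (λ k → (a choose k) · h k)) ⟩
    sum≤ a (λ k → (a choose k) · h k) + (a choose suc a) · h (suc a) + sum≤ a (λ k → (a choose k) · h (suc k))
      ≈⟨ +-congʳ (+-congˡ (reflexive (≡.cong (_· h (suc a)) (k>n⇒nCk≡0 (ℕ.n<1+n a))))) ⟩
    sum≤ a (λ k → (a choose k) · h k) + 0# + sum≤ a (λ k → (a choose k) · h (suc k))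
      ≈⟨ +-congʳ (+-identityʳ _) ⟩
    sum≤ a (λ k → (a choose k) · h k) + sum≤ a (λ k → (a choose k) · h (suc k))
      ∎

  -- The binomial theorem for (1 + yE)^a; `P y 0 (k ℕ.+ m) r` is E^k of the binomial at m.
  P-expand : ∀ y a m r → P y a m r ≈ sum≤ a (λ k → (a choose k) · (y ^ k * P y 0 (k ℕ.+ m) r))
  P-expand y zero    m r = sym (trans (+-identityʳ _) (trans (×-homo-1 _) (*-identityˡ _)))
  P-expand y (suc a) m r = begin
    P y a m r + y * P y a (suc m) r
      ≈⟨ +-cong (P-expand y a m r) (*-congˡ (P-expand y a (suc m) r)) ⟩
    sum≤ a (λ k → (a choose k) · h k) + y * sum≤ a (λ k → (a choose k) · h′ k)
      ≈⟨ +-congˡ (sum≤-*ˡ a y (λ k → (a choose k) · h′ k)) ⟩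
    sum≤ a (λ k → (a choose k) · h k) + sum≤ a (λ k → y * (a choose k) · h′ k)
      ≈⟨ +-congˡ (sum≤-cong a y*h′≈h) ⟩
    sum≤ a (λ k → (a choose k) · h k) + sum≤ a (λ k → (a choose k) · h (suc k))
      ≈⟨ binomialSum-step a h ⟨
    sum≤ (suc a) (λ k → (suc a choose k) · h k)
      ∎
    where
    h h′ : ℕ → Carrier
    h  k = y ^ k * P y 0 (k ℕ.+ m) r
    h′ k = y ^ k * P y 0 (k ℕ.+ suc m) r

    y*h′≈h : ∀ k → y * (a choose k) · h′ k ≈ (a choose k) · h (suc k)
    y*h′≈h k = begin
      y * (a choose k) · h′ k                                     ≈⟨ ×-comm-* (a choose k) y (h′ k) ⟩
      (a choose k) · (y * (y ^ k * P y 0 (k ℕ.+ suc m) r))        ≈⟨ ×-congʳ (a choose k) (*-assoc y (y ^ k) _) ⟨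
      (a choose k) · (y * y ^ k * P y 0 (k ℕ.+ suc m) r)          ≡⟨ ≡.cong (λ j → (a choose k) · (y * y ^ k * P y 0 j r)) (ℕ.+-suc k m) ⟩
      (a choose k) · h (suc k)                                    ∎

  [-x]^k≈[-1]^k*x^k : ∀ x k → (- x) ^ k ≈ (- 1#) ^ k * x ^ k
  [-x]^k≈[-1]^k*x^k x zero    = sym (*-identityˡ 1#)
  [-x]^k≈[-1]^k*x^k x (suc k) = begin
    - x * (- x) ^ k                    ≈⟨ *-cong (sym (-1*x≈-x x)) ([-x]^k≈[-1]^k*x^k x k) ⟩
    - 1# * x * ((- 1#) ^ k * x ^ k)    ≈⟨ solve 4 (λ e x σ p → e :* x :* (σ :* p) := e :* σ :* (x :* p)) refl (- 1#) x ((- 1#) ^ k) (x ^ k) ⟩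
    - 1# * (- 1#) ^ k * (x * x ^ k)    ∎

  legendreCoeff : ℕ → ℕ → Carrier
  legendreCoeff n k = (- 1#) ^ k * ((n choose k) · ((k ℕ.+ n) choose n) · 1#)

  legendre : ℕ → Carrier → Carrier
  legendre n x = sum≤ n (λ k → legendreCoeff n k * x ^ k)

  P≈legendre : ∀ n x → P (- x) n n n ≈ legendre n x
  P≈legendre n x = trans (P-expand (- x) n n n) (sum≤-cong n λ k → begin
    (n choose k) · ((- x) ^ k * b k)              ≈⟨ ×-comm-* (n choose k) ((- x) ^ k) (b k) ⟨
    (- x) ^ k * (n choose k) · b k                ≈⟨ *-congʳ ([-x]^k≈[-1]^k*x^k x k) ⟩
    (- 1#) ^ k * x ^ k * (n choose k) · b k       ≈⟨ solve 3 (λ e x b → e :* x :* b := e :* b :* x) refl ((- 1#) ^ k) (x ^ k) ((n choose k) · b k) ⟩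
    (- 1#) ^ k * (n choose k) · b k * x ^ k       ∎)
    where
    b : ℕ → Carrier
    b k = ((k ℕ.+ n) choose n) · 1#

  -- At a = m = r = n the reflected index a + m - r is n again, so both sides are values of one
  -- polynomial.
  legendre-reflect : ∀ n x → legendre n x ≈ (- 1#) ^ n * legendre n (1# - x)
  legendre-reflect n x = begin
    legendre n x                        ≈⟨ P≈legendre n x ⟨
    P (- x) n n n                       ≈⟨ P-reflect (- (1# - x)) (- x) -x≈ n n n n ≡.refl ⟩
    (- 1#) ^ n * P (- (1# - x)) n n n   ≈⟨ *-congˡ (P≈legendre n (1# - x)) ⟩
    (- 1#) ^ n * legendre n (1# - x)    ∎
    where
    -x≈ : - x ≈ - 1# * (1# + - (1# - x))
    -x≈ = sym (begin
      - 1# * (1# - (1# - x))          ≈⟨ -1*x≈-x _ ⟩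
      - (1# - (1# - x))               ≈⟨ -‿cong (+-congˡ (-[1-x]≈-1+x x)) ⟩
      - (1# + (- 1# + x))             ≈⟨ -‿cong (+-assoc 1# (- 1#) x) ⟨
      - (1# - 1# + x)                 ≈⟨ -‿cong (trans (+-congʳ (-‿inverseʳ 1#)) (+-identityˡ x)) ⟩
      - x                             ∎)
      where
      -[1-x]≈-1+x : ∀ x → - (1# - x) ≈ - 1# + x
      -[1-x]≈-1+x x = trans (sym (-‿+-comm 1# (- x))) (+-congˡ (-‿involutive x))

  sum≤-legendre-difference : ∀ n x →
    sum≤ n (λ k → legendreCoeff n k * (x ^ k - (- 1#) ^ n * (1# - x) ^ k)) ≈ 0#
  sum≤-legendre-difference n x = begin
    sum≤ n (λ k → c k * (x ^ k - σ * (1# - x) ^ k))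
      ≈⟨ sum≤-cong n (λ k → trans (distribˡ (c k) (x ^ k) (- (σ * (1# - x) ^ k))) (+-congˡ (move k))) ⟩
    sum≤ n (λ k → c k * x ^ k + - σ * (c k * (1# - x) ^ k))
      ≈⟨ sum≤-+ n (λ k → c k * x ^ k) (λ k → - σ * (c k * (1# - x) ^ k)) ⟩
    legendre n x + sum≤ n (λ k → - σ * (c k * (1# - x) ^ k))
      ≈⟨ +-congˡ (sum≤-*ˡ n (- σ) (λ k → c k * (1# - x) ^ k)) ⟨
    legendre n x + - σ * legendre n (1# - x)
      ≈⟨ +-cong (legendre-reflect n x) (sym (-‿distribˡ-* σ (legendre n (1# - x)))) ⟩
    σ * legendre n (1# - x) - σ * legendre n (1# - x)
      ≈⟨ -‿inverseʳ _ ⟩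
    0#
      ∎
    where
    σ = (- 1#) ^ n
    c = legendreCoeff n
    move : ∀ k → c k * - (σ * (1# - x) ^ k) ≈ - σ * (c k * (1# - x) ^ k)
    move k = trans (*-congˡ (-‿distribˡ-* σ ((1# - x) ^ k)))
      (solve 3 (λ c s z → c :* (s :* z) := s :* (c :* z)) refl (c k) (- σ) ((1# - x) ^ k))

open ≡ using (refl; sym; trans; cong; cong₂; subst; module ≡-Reasoning)
open +-*-Solver using (_:+_; _:*_; _:-_; _:=_) renaming (solve to solveℚ)

-- The commutative ring ℚ[x] of coefficient lists.

coeff-+ : ∀ f g n → coeff (f +ᴾ g) n ≡ coeff f n ℚ.+ coeff g n
coeff-+ []      g       n       = sym (ℚ.+-identityˡ (coeff g n))
coeff-+ (a ∷ f) []      n       = sym (ℚ.+-identityʳ (coeff (a ∷ f) n))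
coeff-+ (a ∷ f) (b ∷ g) zero    = refl
coeff-+ (a ∷ f) (b ∷ g) (suc n) = coeff-+ f g n

coeff-neg : ∀ f n → coeff (-ᴾ f) n ≡ ℚ.- coeff f n
coeff-neg []      n       = refl
coeff-neg (a ∷ f) zero    = refl
coeff-neg (a ∷ f) (suc n) = coeff-neg f n

coeff-scale : ∀ a f n → coeff (map (a ℚ.*_) f) n ≡ a ℚ.* coeff f n
coeff-scale a []      n       = sym (ℚ.*-zeroʳ a)
coeff-scale a (b ∷ f) zero    = refl
coeff-scale a (b ∷ f) (suc n) = coeff-scale a f n

shift-cong : ∀ f g → f ≈ᴾ g → (0ℚ ∷ f) ≈ᴾ (0ℚ ∷ g)
shift-cong f g f≈g zero    = refl
shift-cong f g f≈g (suc n) = f≈g n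

coeff-shift-[] : ∀ n → coeff (0ℚ ∷ []) n ≡ 0ℚ
coeff-shift-[] zero    = refl
coeff-shift-[] (suc n) = refl

coeff-shift-+ : ∀ f g n →
  coeff (0ℚ ∷ (f +ᴾ g)) n ≡ coeff (0ℚ ∷ f) n ℚ.+ coeff (0ℚ ∷ g) n
coeff-shift-+ f g zero    = refl
coeff-shift-+ f g (suc n) = coeff-+ f g n

coeff-shift-scale : ∀ a f n →
  coeff (0ℚ ∷ map (a ℚ.*_) f) n ≡ a ℚ.* coeff (0ℚ ∷ f) n
coeff-shift-scale a f zero    = sym (ℚ.*-zeroʳ a)
coeff-shift-scale a f (suc n) = coeff-scale a f n

-- `coeff (0ℚ ∷ h) n` is the coefficient of h at n - 1, read as 0 at n = 0. Keeping it in this form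
-- spares most ring laws a case split on n.
coeff-∷-* : ∀ a f g n →
  coeff ((a ∷ f) *ᴾ g) n ≡ a ℚ.* coeff g n ℚ.+ coeff (0ℚ ∷ (f *ᴾ g)) n
coeff-∷-* a f g n = begin
  coeff (map (a ℚ.*_) g +ᴾ (0ℚ ∷ (f *ᴾ g))) n
    ≡⟨ coeff-+ (map (a ℚ.*_) g) (0ℚ ∷ (f *ᴾ g)) n ⟩
  coeff (map (a ℚ.*_) g) n ℚ.+ coeff (0ℚ ∷ (f *ᴾ g)) n
    ≡⟨ cong (ℚ._+ coeff (0ℚ ∷ (f *ᴾ g)) n) (coeff-scale a g n) ⟩
  a ℚ.* coeff g n ℚ.+ coeff (0ℚ ∷ (f *ᴾ g)) n
    ∎
  where open ≡-Reasoning

coeff-C-* : ∀ a f n → coeff (C a *ᴾ f) n ≡ a ℚ.* coeff f n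
coeff-C-* a f n = begin
  coeff (C a *ᴾ f) n                        ≡⟨ coeff-∷-* a [] f n ⟩
  a ℚ.* coeff f n ℚ.+ coeff (0ℚ ∷ []) n     ≡⟨ cong (a ℚ.* coeff f n ℚ.+_) (coeff-shift-[] n) ⟩
  a ℚ.* coeff f n ℚ.+ 0ℚ                    ≡⟨ ℚ.+-identityʳ _ ⟩
  a ℚ.* coeff f n                           ∎
  where open ≡-Reasoning

*ᴾ-zeroʳ : ∀ f → f *ᴾ [] ≈ᴾ []
*ᴾ-zeroʳ []      n       = refl
*ᴾ-zeroʳ (a ∷ f) zero    = refl
*ᴾ-zeroʳ (a ∷ f) (suc n) = *ᴾ-zeroʳ f n

*ᴾ-congˡ : ∀ f g h → g ≈ᴾ h → f *ᴾ g ≈ᴾ f *ᴾ h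
*ᴾ-congˡ []      g h g≈h n = refl
*ᴾ-congˡ (a ∷ f) g h g≈h n = begin
  coeff ((a ∷ f) *ᴾ g) n                        ≡⟨ coeff-∷-* a f g n ⟩
  a ℚ.* coeff g n ℚ.+ coeff (0ℚ ∷ (f *ᴾ g)) n   ≡⟨ cong₂ (λ b c → a ℚ.* b ℚ.+ c) (g≈h n) (shift-cong (f *ᴾ g) (f *ᴾ h) (*ᴾ-congˡ f g h g≈h) n) ⟩
  a ℚ.* coeff h n ℚ.+ coeff (0ℚ ∷ (f *ᴾ h)) n   ≡⟨ coeff-∷-* a f h n ⟨
  coeff ((a ∷ f) *ᴾ h) n                        ∎
  where open ≡-Reasoning

-- The mirror image of the recursion on the left factor that defines `_*ᴾ_`. The two recursions
-- together make commutativity an induction, and commutativity turns laws for one factor into laws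
-- for the other.
coeff-*-∷ : ∀ g a f n →
  coeff (g *ᴾ (a ∷ f)) n ≡ a ℚ.* coeff g n ℚ.+ coeff (0ℚ ∷ (g *ᴾ f)) n
coeff-*-∷ []      a f n = begin
  0ℚ                                      ≡⟨ coeff-shift-[] n ⟨
  coeff (0ℚ ∷ []) n                       ≡⟨ ℚ.+-identityˡ _ ⟨
  0ℚ ℚ.+ coeff (0ℚ ∷ []) n                ≡⟨ cong (ℚ._+ coeff (0ℚ ∷ []) n) (ℚ.*-zeroʳ a) ⟨
  a ℚ.* 0ℚ ℚ.+ coeff (0ℚ ∷ []) n          ∎
  where open ≡-Reasoning
coeff-*-∷ (b ∷ g) a f zero    = cong (ℚ._+ 0ℚ) (ℚ.*-comm b a)
coeff-*-∷ (b ∷ g) a f (suc n) = begin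
  coeff ((b ∷ g) *ᴾ (a ∷ f)) (suc n)
    ≡⟨ coeff-∷-* b g (a ∷ f) (suc n) ⟩
  b ℚ.* coeff f n ℚ.+ coeff (g *ᴾ (a ∷ f)) n
    ≡⟨ cong (b ℚ.* coeff f n ℚ.+_) (coeff-*-∷ g a f n) ⟩
  b ℚ.* coeff f n ℚ.+ (a ℚ.* coeff g n ℚ.+ coeff (0ℚ ∷ (g *ᴾ f)) n)
    ≡⟨ solveℚ 3 (λ x y z → x :+ (y :+ z) := y :+ (x :+ z)) refl (b ℚ.* coeff f n) (a ℚ.* coeff g n) (coeff (0ℚ ∷ (g *ᴾ f)) n) ⟩
  a ℚ.* coeff g n ℚ.+ (b ℚ.* coeff f n ℚ.+ coeff (0ℚ ∷ (g *ᴾ f)) n)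
    ≡⟨ cong (a ℚ.* coeff g n ℚ.+_) (coeff-∷-* b g f n) ⟨
  a ℚ.* coeff g n ℚ.+ coeff ((b ∷ g) *ᴾ f) n
    ∎
  where open ≡-Reasoning

*ᴾ-comm : ∀ f g → f *ᴾ g ≈ᴾ g *ᴾ f
*ᴾ-comm []      g n = sym (*ᴾ-zeroʳ g n)
*ᴾ-comm (a ∷ f) g n = begin
  coeff ((a ∷ f) *ᴾ g) n                        ≡⟨ coeff-∷-* a f g n ⟩
  a ℚ.* coeff g n ℚ.+ coeff (0ℚ ∷ (f *ᴾ g)) n   ≡⟨ cong (a ℚ.* coeff g n ℚ.+_) (shift-cong (f *ᴾ g) (g *ᴾ f) (*ᴾ-comm f g) n) ⟩
  a ℚ.* coeff g n ℚ.+ coeff (0ℚ ∷ (g *ᴾ f)) n   ≡⟨ coeff-*-∷ g a f n ⟨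
  coeff (g *ᴾ (a ∷ f)) n                        ∎
  where open ≡-Reasoning

*ᴾ-cong : ∀ {f f′ g g′} → f ≈ᴾ f′ → g ≈ᴾ g′ → f *ᴾ g ≈ᴾ f′ *ᴾ g′
*ᴾ-cong {f} {f′} {g} {g′} f≈f′ g≈g′ n = begin
  coeff (f *ᴾ g) n     ≡⟨ *ᴾ-congˡ f g g′ g≈g′ n ⟩
  coeff (f *ᴾ g′) n    ≡⟨ *ᴾ-comm f g′ n ⟩
  coeff (g′ *ᴾ f) n    ≡⟨ *ᴾ-congˡ g′ f f′ f≈f′ n ⟩
  coeff (g′ *ᴾ f′) n   ≡⟨ *ᴾ-comm g′ f′ n ⟩
  coeff (f′ *ᴾ g′) n   ∎
  where open ≡-Reasoning

*ᴾ-distribˡ-+ᴾ : ∀ f g h → f *ᴾ (g +ᴾ h) ≈ᴾ f *ᴾ g +ᴾ f *ᴾ h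
*ᴾ-distribˡ-+ᴾ []      g h n = refl
*ᴾ-distribˡ-+ᴾ (a ∷ f) g h n = begin
  coeff ((a ∷ f) *ᴾ (g +ᴾ h)) n
    ≡⟨ coeff-∷-* a f (g +ᴾ h) n ⟩
  a ℚ.* coeff (g +ᴾ h) n ℚ.+ coeff (0ℚ ∷ (f *ᴾ (g +ᴾ h))) n
    ≡⟨ cong₂ (λ b c → a ℚ.* b ℚ.+ c) (coeff-+ g h n)
         (trans (shift-cong (f *ᴾ (g +ᴾ h)) (f *ᴾ g +ᴾ f *ᴾ h) (*ᴾ-distribˡ-+ᴾ f g h) n)
                (coeff-shift-+ (f *ᴾ g) (f *ᴾ h) n)) ⟩
  a ℚ.* (coeff g n ℚ.+ coeff h n) ℚ.+ (coeff (0ℚ ∷ (f *ᴾ g)) n ℚ.+ coeff (0ℚ ∷ (f *ᴾ h)) n)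
    ≡⟨ solveℚ 5 (λ a x y u v → a :* (x :+ y) :+ (u :+ v) := (a :* x :+ u) :+ (a :* y :+ v)) refl
         a (coeff g n) (coeff h n) (coeff (0ℚ ∷ (f *ᴾ g)) n) (coeff (0ℚ ∷ (f *ᴾ h)) n) ⟩
  (a ℚ.* coeff g n ℚ.+ coeff (0ℚ ∷ (f *ᴾ g)) n) ℚ.+ (a ℚ.* coeff h n ℚ.+ coeff (0ℚ ∷ (f *ᴾ h)) n)
    ≡⟨ cong₂ ℚ._+_ (coeff-∷-* a f g n) (coeff-∷-* a f h n) ⟨
  coeff ((a ∷ f) *ᴾ g) n ℚ.+ coeff ((a ∷ f) *ᴾ h) n
    ≡⟨ coeff-+ ((a ∷ f) *ᴾ g) ((a ∷ f) *ᴾ h) n ⟨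
  coeff ((a ∷ f) *ᴾ g +ᴾ (a ∷ f) *ᴾ h) n
    ∎
  where open ≡-Reasoning

*ᴾ-distribʳ-+ᴾ : ∀ f g h → (g +ᴾ h) *ᴾ f ≈ᴾ g *ᴾ f +ᴾ h *ᴾ f
*ᴾ-distribʳ-+ᴾ f g h n = begin
  coeff ((g +ᴾ h) *ᴾ f) n                    ≡⟨ *ᴾ-comm (g +ᴾ h) f n ⟩
  coeff (f *ᴾ (g +ᴾ h)) n                    ≡⟨ *ᴾ-distribˡ-+ᴾ f g h n ⟩
  coeff (f *ᴾ g +ᴾ f *ᴾ h) n                 ≡⟨ coeff-+ (f *ᴾ g) (f *ᴾ h) n ⟩
  coeff (f *ᴾ g) n ℚ.+ coeff (f *ᴾ h) n      ≡⟨ cong₂ ℚ._+_ (*ᴾ-comm f g n) (*ᴾ-comm f h n) ⟩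
  coeff (g *ᴾ f) n ℚ.+ coeff (h *ᴾ f) n      ≡⟨ coeff-+ (g *ᴾ f) (h *ᴾ f) n ⟨
  coeff (g *ᴾ f +ᴾ h *ᴾ f) n                 ∎
  where open ≡-Reasoning

scale-*ᴾ : ∀ a f g → map (a ℚ.*_) f *ᴾ g ≈ᴾ map (a ℚ.*_) (f *ᴾ g)
scale-*ᴾ a []      g n = refl
scale-*ᴾ a (b ∷ f) g n = begin
  coeff ((a ℚ.* b ∷ map (a ℚ.*_) f) *ᴾ g) n
    ≡⟨ coeff-∷-* (a ℚ.* b) (map (a ℚ.*_) f) g n ⟩
  a ℚ.* b ℚ.* coeff g n ℚ.+ coeff (0ℚ ∷ (map (a ℚ.*_) f *ᴾ g)) n
    ≡⟨ cong (a ℚ.* b ℚ.* coeff g n ℚ.+_)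
         (trans (shift-cong (map (a ℚ.*_) f *ᴾ g) (map (a ℚ.*_) (f *ᴾ g)) (scale-*ᴾ a f g) n)
                (coeff-shift-scale a (f *ᴾ g) n)) ⟩
  a ℚ.* b ℚ.* coeff g n ℚ.+ a ℚ.* coeff (0ℚ ∷ (f *ᴾ g)) n
    ≡⟨ solveℚ 4 (λ a b x y → a :* b :* x :+ a :* y := a :* (b :* x :+ y)) refl
         a b (coeff g n) (coeff (0ℚ ∷ (f *ᴾ g)) n) ⟩
  a ℚ.* (b ℚ.* coeff g n ℚ.+ coeff (0ℚ ∷ (f *ᴾ g)) n)
    ≡⟨ cong (a ℚ.*_) (coeff-∷-* b f g n) ⟨
  a ℚ.* coeff ((b ∷ f) *ᴾ g) n
    ≡⟨ coeff-scale a ((b ∷ f) *ᴾ g) n ⟨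
  coeff (map (a ℚ.*_) ((b ∷ f) *ᴾ g)) n
    ∎
  where open ≡-Reasoning

shift-*ᴾ : ∀ f g → (0ℚ ∷ f) *ᴾ g ≈ᴾ (0ℚ ∷ (f *ᴾ g))
shift-*ᴾ f g n = begin
  coeff ((0ℚ ∷ f) *ᴾ g) n                         ≡⟨ coeff-∷-* 0ℚ f g n ⟩
  0ℚ ℚ.* coeff g n ℚ.+ coeff (0ℚ ∷ (f *ᴾ g)) n    ≡⟨ cong (ℚ._+ coeff (0ℚ ∷ (f *ᴾ g)) n) (ℚ.*-zeroˡ (coeff g n)) ⟩
  0ℚ ℚ.+ coeff (0ℚ ∷ (f *ᴾ g)) n                  ≡⟨ ℚ.+-identityˡ _ ⟩
  coeff (0ℚ ∷ (f *ᴾ g)) n                         ∎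
  where open ≡-Reasoning

-- Multiplication by `a ∷ f` is a scaling plus a shift, and both can be pulled out of a left factor.
*ᴾ-assoc : ∀ f g h → (f *ᴾ g) *ᴾ h ≈ᴾ f *ᴾ (g *ᴾ h)
*ᴾ-assoc []      g h n = refl
*ᴾ-assoc (a ∷ f) g h n = begin
  coeff ((ag +ᴾ (0ℚ ∷ (f *ᴾ g))) *ᴾ h) n
    ≡⟨ *ᴾ-distribʳ-+ᴾ h ag (0ℚ ∷ (f *ᴾ g)) n ⟩
  coeff (ag *ᴾ h +ᴾ (0ℚ ∷ (f *ᴾ g)) *ᴾ h) n
    ≡⟨ coeff-+ (ag *ᴾ h) ((0ℚ ∷ (f *ᴾ g)) *ᴾ h) n ⟩
  coeff (ag *ᴾ h) n ℚ.+ coeff ((0ℚ ∷ (f *ᴾ g)) *ᴾ h) n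
    ≡⟨ cong₂ ℚ._+_
         (trans (scale-*ᴾ a g h n) (coeff-scale a (g *ᴾ h) n))
         (trans (shift-*ᴾ (f *ᴾ g) h n)
                (shift-cong ((f *ᴾ g) *ᴾ h) (f *ᴾ (g *ᴾ h)) (*ᴾ-assoc f g h) n)) ⟩
  a ℚ.* coeff (g *ᴾ h) n ℚ.+ coeff (0ℚ ∷ (f *ᴾ (g *ᴾ h))) n
    ≡⟨ coeff-∷-* a f (g *ᴾ h) n ⟨
  coeff ((a ∷ f) *ᴾ (g *ᴾ h)) n
    ∎
  where
  open ≡-Reasoning
  ag = map (a ℚ.*_) g

*ᴾ-identityˡ : ∀ f → 1ᴾ *ᴾ f ≈ᴾ f
*ᴾ-identityˡ f n = trans (coeff-C-* 1ℚ f n) (ℚ.*-identityˡ (coeff f n))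

+ᴾ-cong : ∀ {f f′ g g′} → f ≈ᴾ f′ → g ≈ᴾ g′ → f +ᴾ g ≈ᴾ f′ +ᴾ g′
+ᴾ-cong {f} {f′} {g} {g′} f≈f′ g≈g′ n =
  trans (coeff-+ f g n) (trans (cong₂ ℚ._+_ (f≈f′ n) (g≈g′ n)) (sym (coeff-+ f′ g′ n)))

+ᴾ-assoc : ∀ f g h → (f +ᴾ g) +ᴾ h ≈ᴾ f +ᴾ (g +ᴾ h)
+ᴾ-assoc f g h n = begin
  coeff ((f +ᴾ g) +ᴾ h) n                     ≡⟨ coeff-+ (f +ᴾ g) h n ⟩
  coeff (f +ᴾ g) n ℚ.+ coeff h n              ≡⟨ cong (ℚ._+ coeff h n) (coeff-+ f g n) ⟩
  coeff f n ℚ.+ coeff g n ℚ.+ coeff h n       ≡⟨ ℚ.+-assoc (coeff f n) (coeff g n) (coeff h n) ⟩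
  coeff f n ℚ.+ (coeff g n ℚ.+ coeff h n)     ≡⟨ cong (coeff f n ℚ.+_) (coeff-+ g h n) ⟨
  coeff f n ℚ.+ coeff (g +ᴾ h) n              ≡⟨ coeff-+ f (g +ᴾ h) n ⟨
  coeff (f +ᴾ (g +ᴾ h)) n                     ∎
  where open ≡-Reasoning

+ᴾ-comm : ∀ f g → f +ᴾ g ≈ᴾ g +ᴾ f
+ᴾ-comm f g n =
  trans (coeff-+ f g n) (trans (ℚ.+-comm (coeff f n) (coeff g n)) (sym (coeff-+ g f n)))

+ᴾ-identityʳ : ∀ f → f +ᴾ 0ᴾ ≈ᴾ f
+ᴾ-identityʳ f n = trans (coeff-+ f 0ᴾ n) (ℚ.+-identityʳ (coeff f n))

-ᴾ-cong : ∀ {f g} → f ≈ᴾ g → -ᴾ f ≈ᴾ -ᴾ g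
-ᴾ-cong {f} {g} f≈g n =
  trans (coeff-neg f n) (trans (cong ℚ.-_ (f≈g n)) (sym (coeff-neg g n)))

-ᴾ-inverseʳ : ∀ f → f +ᴾ (-ᴾ f) ≈ᴾ 0ᴾ
-ᴾ-inverseʳ f n = begin
  coeff (f +ᴾ (-ᴾ f)) n              ≡⟨ coeff-+ f (-ᴾ f) n ⟩
  coeff f n ℚ.+ coeff (-ᴾ f) n       ≡⟨ cong (coeff f n ℚ.+_) (coeff-neg f n) ⟩
  coeff f n ℚ.+ (ℚ.- coeff f n)      ≡⟨ ℚ.+-inverseʳ (coeff f n) ⟩
  0ℚ                                 ∎
  where open ≡-Reasoning

≈ᴾ-isEquivalence : IsEquivalence _≈ᴾ_
≈ᴾ-isEquivalence = record
  { refl  = λ n → refl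
  ; sym   = λ f≈g n → sym (f≈g n)
  ; trans = λ f≈g g≈h n → trans (f≈g n) (g≈h n)
  }

polyIsCommutativeRing : IsCommutativeRing _≈ᴾ_ _+ᴾ_ _*ᴾ_ -ᴾ_ 0ᴾ 1ᴾ
polyIsCommutativeRing = record
  { isRing = record
    { +-isAbelianGroup = record
      { isGroup = record
        { isMonoid = record
          { isSemigroup = record
            { isMagma = record
              { isEquivalence = ≈ᴾ-isEquivalence
              ; ∙-cong        = λ {f f′ g g′} → +ᴾ-cong {f} {f′} {g} {g′}
              }
            ; assoc = +ᴾ-assoc
            }
          ; identity = (λ f n → refl) , +ᴾ-identityʳ
          }
        ; inverse =
            (λ f n → trans (+ᴾ-comm (-ᴾ f) f n) (-ᴾ-inverseʳ f n)) , -ᴾ-inverseʳ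
        ; ⁻¹-cong = λ {f g} → -ᴾ-cong {f} {g}
        }
      ; comm = +ᴾ-comm
      }
    ; *-cong     = λ {f f′ g g′} → *ᴾ-cong {f} {f′} {g} {g′}
    ; *-assoc    = *ᴾ-assoc
    ; *-identity =
        *ᴾ-identityˡ , λ f n → trans (*ᴾ-comm f 1ᴾ n) (*ᴾ-identityˡ f n)
    ; distrib    = *ᴾ-distribˡ-+ᴾ , *ᴾ-distribʳ-+ᴾ
    }
  ; *-comm = *ᴾ-comm
  }

polyCommutativeRing : CommutativeRing 0ℓ 0ℓ
polyCommutativeRing = record { isCommutativeRing = polyIsCommutativeRing }

open import Data.Nat.Base using (_+_; _*_; _^_; _∸_; _!)

-- Integer recurrences and the divisibility behind the congruence of coefficients.

k≤n⇒nCk*k![n∸k]!≡n! : ∀ {n k} → k ≤ n → (n choose k) * (k ! * (n ∸ k) !) ≡ n !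
k≤n⇒nCk*k![n∸k]!≡n! {n} {k} k≤n = begin
  (n choose k) * (k ! * (n ∸ k) !)                           ≡⟨ cong (_* (k ! * (n ∸ k) !)) (nCk≡n!/k![n-k]! k≤n) ⟩
  (n ! / (k ! * (n ∸ k) !)) * (k ! * (n ∸ k) !)         ≡⟨ m/n*n≡m (k![n∸k]!∣n! k≤n) ⟩
  n !                                                   ∎
  where
  open ≡-Reasoning
  instance _ = ℕ._!*_!≢0 k (n ∸ k)

[m+n]Cm*m!n!≡[m+n]! : ∀ m n → ((m + n) choose m) * (m ! * n !) ≡ (m + n) !
[m+n]Cm*m!n!≡[m+n]! m n = trans
  (cong (λ j → ((m + n) choose m) * (m ! * j !)) (sym (ℕ.m+n∸m≡n m n)))
  (k≤n⇒nCk*k![n∸k]!≡n! (ℕ.m≤m+n m n))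

absCoeff : ℕ → ℕ → ℕ
absCoeff n k = (n choose k) * ((k + n) choose n)

-- C(n,k) C(n+k,n) = (n+k)! / (k!² (n-k)!), cleared of denominators; d stands for n - k.
absCoeff-! : ∀ k d → let n = k + d in absCoeff n k * (k ! * k !) * d ! ≡ (k + n) !
absCoeff-! k d = begin
  (n choose k) * ((k + n) choose n) * (k ! * k !) * d !       ≡⟨ rearrange (n choose k) ((k + n) choose n) (k !) (d !) ⟩
  ((k + n) choose n) * ((n choose k) * (k ! * d !) * k !)     ≡⟨ cong (λ x → ((k + n) choose n) * (x * k !)) ([m+n]Cm*m!n!≡[m+n]! k d) ⟩
  ((k + n) choose n) * (n ! * k !)                       ≡⟨ cong (λ j → (j choose n) * (n ! * k !)) (ℕ.+-comm k n) ⟩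
  ((n + k) choose n) * (n ! * k !)                       ≡⟨ [m+n]Cm*m!n!≡[m+n]! n k ⟩
  (n + k) !                                         ≡⟨ cong _! (ℕ.+-comm n k) ⟩
  (k + n) !                                         ∎
  where
  open ≡-Reasoning
  n = k + d
  rearrange : ∀ a b f g → a * b * (f * f) * g ≡ b * (a * (f * g) * f)
  rearrange = solveℕ-∀

absCoeff-suc : ∀ k d → let n = suc k + d in
  absCoeff n (suc k) * (suc k ! * suc k !) ≡
  (suc k + n) * suc d * (absCoeff n k * (k ! * k !))
absCoeff-suc k d = ℕ.*-cancelʳ-≡ _ _ (d !) {{ℕ._!≢0 d}} (begin
  absCoeff n (suc k) * (suc k ! * suc k !) * d !                  ≡⟨ absCoeff-! (suc k) d ⟩
  -- The same n is split as k + (1 + d), so the factorial formula applies at k as well.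
  (suc k + n) * (k + n) !                                         ≡⟨ cong ((suc k + n) *_) (subst (λ m → absCoeff m k * (k ! * k !) * suc d ! ≡ (k + m) !) (ℕ.+-suc k d) (absCoeff-! k (suc d))) ⟨
  (suc k + n) * (absCoeff n k * (k ! * k !) * (suc d * d !))      ≡⟨ rearrange (suc k + n) (absCoeff n k * (k ! * k !)) (suc d) (d !) ⟩
  (suc k + n) * suc d * (absCoeff n k * (k ! * k !)) * d !        ∎)
  where
  open ≡-Reasoning
  n = suc k + d
  rearrange : ∀ a b f g → a * (b * (f * g)) ≡ a * f * b * g
  rearrange = solveℕ-∀

denom : ℕ → ℕ
denom k = 27 ^ k * (k !) ^ 3

-- Multiplying by the denominator of `w k` moves the comparison with (3k)! into the integers.
scaledCoeff : ℕ → ℕ → ℕ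
scaledCoeff n k = absCoeff n k * denom k

-- The denominator contributes 27 (k+1)³; the recurrence of `absCoeff` uses up two of the factors k
-- + 1.
scaledCoeff-suc : ∀ k d → let n = suc k + d in
  scaledCoeff n (suc k) ≡ 27 * (suc k * ((suc k + n) * suc d)) * scaledCoeff n k
scaledCoeff-suc k d = begin
  absCoeff n (suc k) * (27 * 27 ^ k * (suc k !) ^ 3)
    ≡⟨ split (absCoeff n (suc k)) (27 ^ k) (suc k !) ⟩
  27 * 27 ^ k * suc k ! * (absCoeff n (suc k) * (suc k ! * suc k !))
    ≡⟨ cong (27 * 27 ^ k * suc k ! *_) (absCoeff-suc k d) ⟩
  27 * 27 ^ k * (suc k * k !) * ((suc k + n) * suc d * (absCoeff n k * (k ! * k !)))
    ≡⟨ collect (27 ^ k) (suc k) (k !) (suc k + n) (suc d) (absCoeff n k) ⟩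
  27 * (suc k * ((suc k + n) * suc d)) * scaledCoeff n k
    ∎
  where
  open ≡-Reasoning
  n = suc k + d
  split : ∀ b t f → b * (27 * t * (f * (f * (f * 1)))) ≡ 27 * t * f * (b * (f * f))
  split = solveℕ-∀
  collect : ∀ t s f u v b → 27 * t * (s * f) * (u * v * (b * (f * f))) ≡
    27 * (s * (u * v)) * (b * (t * (f * (f * (f * 1)))))
  collect = solveℕ-∀

signedCoeff : ℕ → ℕ → ℤ
signedCoeff n k = -1ℤ ℤ.^ k ℤ.* + absCoeff n k

pos-*₄ : ∀ a b c d → + (a * (b * (c * d))) ≡ + a ℤ.* (+ b ℤ.* (+ c ℤ.* + d))
pos-*₄ a b c d = begin
  + (a * (b * (c * d)))               ≡⟨ ℤ.pos-* a (b * (c * d)) ⟩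
  + a ℤ.* + (b * (c * d))             ≡⟨ cong (+ a ℤ.*_) (ℤ.pos-* b (c * d)) ⟩
  + a ℤ.* (+ b ℤ.* + (c * d))         ≡⟨ cong (λ z → + a ℤ.* (+ b ℤ.* z)) (ℤ.pos-* c d) ⟩
  + a ℤ.* (+ b ℤ.* (+ c ℤ.* + d))     ∎
  where open ≡-Reasoning

[3k]!-suc : ∀ k → + ((3 * suc k) !) ≡
  (+ 3 ℤ.+ + 3 ℤ.* + k) ℤ.* ((+ 2 ℤ.+ + 3 ℤ.* + k) ℤ.* ((+ 1 ℤ.+ + 3 ℤ.* + k) ℤ.* + ((3 * k) !)))
[3k]!-suc k = begin
  + ((3 * suc k) !)
    ≡⟨ cong (λ m → + (m !)) (ℕ.*-suc 3 k) ⟩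
  + ((3 + t) * ((2 + t) * ((1 + t) * t !)))
    ≡⟨ pos-*₄ (3 + t) (2 + t) (1 + t) (t !) ⟩
  (+ 3 ℤ.+ + t) ℤ.* ((+ 2 ℤ.+ + t) ℤ.* ((+ 1 ℤ.+ + t) ℤ.* + (t !)))
    ≡⟨ cong (λ z → (+ 3 ℤ.+ z) ℤ.* ((+ 2 ℤ.+ z) ℤ.* ((+ 1 ℤ.+ z) ℤ.* + (t !)))) (ℤ.pos-* 3 k) ⟩
  (+ 3 ℤ.+ + 3 ℤ.* + k) ℤ.* ((+ 2 ℤ.+ + 3 ℤ.* + k) ℤ.* ((+ 1 ℤ.+ + 3 ℤ.* + k) ℤ.* + (t !)))
    ∎
  where
  open ≡-Reasoning
  t = 3 * k

scaledCoeff-sucℤ : ∀ k d → let n = suc k + d in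
  + scaledCoeff n (suc k) ≡
  + 27 ℤ.* ((+ 1 ℤ.+ + k) ℤ.* ((+ 1 ℤ.+ + k ℤ.+ + n) ℤ.* (+ 1 ℤ.+ + d))) ℤ.* + scaledCoeff n k
scaledCoeff-sucℤ k d = begin
  + scaledCoeff n (suc k)
    ≡⟨ cong +_ (scaledCoeff-suc k d) ⟩
  + (27 * (suc k * ((suc k + n) * suc d)) * scaledCoeff n k)
    ≡⟨ ℤ.pos-* (27 * (suc k * ((suc k + n) * suc d))) (scaledCoeff n k) ⟩
  + (27 * (suc k * ((suc k + n) * suc d))) ℤ.* + scaledCoeff n k
    ≡⟨ cong (ℤ._* + scaledCoeff n k) (pos-*₄ 27 (suc k) (suc k + n) (suc d)) ⟩
  + 27 ℤ.* (+ suc k ℤ.* (+ (suc k + n) ℤ.* + suc d)) ℤ.* + scaledCoeff n k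
    ∎
  where
  open ≡-Reasoning
  n = suc k + d

-- With n = 1 + k + d one has (3k + 1)(3k + 2) + 9(n + k + 1)(n − k) = (3n + 1)(3n + 2).
defect-suc : ∀ k d f s m → let n = + 1 ℤ.+ k ℤ.+ d in
  (+ 3 ℤ.+ + 3 ℤ.* k) ℤ.* ((+ 2 ℤ.+ + 3 ℤ.* k) ℤ.* ((+ 1 ℤ.+ + 3 ℤ.* k) ℤ.* f))
    ℤ.- -1ℤ ℤ.* s ℤ.* (+ 27 ℤ.* ((+ 1 ℤ.+ k) ℤ.* ((+ 1 ℤ.+ k ℤ.+ n) ℤ.* (+ 1 ℤ.+ d))) ℤ.* m)
  ≡ (+ 3 ℤ.+ + 3 ℤ.* k) ℤ.* ((+ 2 ℤ.+ + 3 ℤ.* k) ℤ.* (+ 1 ℤ.+ + 3 ℤ.* k)) ℤ.* (f ℤ.- s ℤ.* m)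
    ℤ.+ (+ 3 ℤ.+ + 3 ℤ.* k) ℤ.* (s ℤ.* m) ℤ.* ((+ 1 ℤ.+ + 3 ℤ.* n) ℤ.* (+ 2 ℤ.+ + 3 ℤ.* n))
defect-suc = solveℤ-∀

module _ {p : ℤ} {n : ℕ} (p∣[1+3n][2+3n] : p ℤ.∣ (+ 1 ℤ.+ + 3 ℤ.* + n) ℤ.* (+ 2 ℤ.+ + 3 ℤ.* + n)) where

  -- The numerator of `w k` minus the signed Legendre coefficient, over the denominator `denom k`.
  defect : ℕ → ℤ
  defect k = + ((3 * k) !) ℤ.- -1ℤ ℤ.^ k ℤ.* + scaledCoeff n k

  -- The next defect is an integer combination of the present one and (1 + 3n)(2 + 3n), so the
  -- induction involves no division modulo p.
  ∣-defect-suc : ∀ k d → n ≡ suc k + d → p ℤ.∣ defect k → p ℤ.∣ defect (suc k)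
  ∣-defect-suc k d refl p∣defect = subst (p ℤ.∣_) (sym step)
    (ℤ.∣m∣n⇒∣m+n (ℤ.∣n⇒∣m*n ((+ 3 ℤ.+ + 3 ℤ.* + k) ℤ.* ((+ 2 ℤ.+ + 3 ℤ.* + k) ℤ.* (+ 1 ℤ.+ + 3 ℤ.* + k))) p∣defect)
      (ℤ.∣n⇒∣m*n ((+ 3 ℤ.+ + 3 ℤ.* + k) ℤ.* (-1ℤ ℤ.^ k ℤ.* + scaledCoeff n k)) p∣[1+3n][2+3n]))
    where
    step = trans
      (cong₂ (λ x y → x ℤ.- -1ℤ ℤ.^ suc k ℤ.* y) ([3k]!-suc k) (scaledCoeff-sucℤ k d))
      (defect-suc (+ k) (+ d) (+ ((3 * k) !)) (-1ℤ ℤ.^ k) (+ scaledCoeff n k))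

  ∣-defect : ∀ k → k ≤ n → p ℤ.∣ defect k
  -- At k = 0 both terms are 1, so the quotient is 0.
  ∣-defect zero    _   = ℤ.divides ℤ.0ℤ (cong (λ b → + 1 ℤ.- 1ℤ ℤ.* + b) scaledCoeff-0)
    where
    open ≡-Reasoning
    scaledCoeff-0 : scaledCoeff n 0 ≡ 1
    scaledCoeff-0 = begin
      scaledCoeff n 0                          ≡⟨ ℕ.*-identityʳ (absCoeff n 0) ⟩
      1 * (n choose n)                              ≡⟨ ℕ.*-identityˡ (n choose n) ⟩
      n choose n                                    ≡⟨ nCn≡1 n ⟩
      1                                        ∎
  ∣-defect (suc k) k<n =
    ∣-defect-suc k (n ∸ suc k) (sym (ℕ.m+[n∸m]≡n k<n)) (∣-defect k (ℕ.<⇒≤ k<n))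

  ∣-signedDefect : ∀ k → k ≤ n → p ℤ.∣ + ((3 * k) !) ℤ.- signedCoeff n k ℤ.* + denom k
  ∣-signedDefect k k≤n = subst (λ z → p ℤ.∣ + ((3 * k) !) ℤ.- z)
    (trans (cong (-1ℤ ℤ.^ k ℤ.*_) (ℤ.pos-* (absCoeff n k) (denom k)))
           (sym (ℤ.*-assoc (-1ℤ ℤ.^ k) (+ absCoeff n k) (+ denom k))))
    (∣-defect k k≤n)

-- From integers to rationals.

fromℤ : ℤ → ℚ
fromℤ i = i ℚ./ 1

-- Arithmetic in ℚ reduces by a gcd, which does not compute on variables; for unnormalised fractions
-- the claim is a cross multiplication.
fromℤ-+ : ∀ i j → fromℤ (i ℤ.+ j) ≡ fromℤ i ℚ.+ fromℤ j
fromℤ-+ i j = ℚ.toℚᵘ-injective (begin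
  ℚ.toℚᵘ (fromℤ (i ℤ.+ j))                    ≈⟨ ℚ.toℚᵘ-fromℚᵘ (mkℚᵘ (i ℤ.+ j) 0) ⟩
  mkℚᵘ (i ℤ.+ j) 0                            ≈⟨ *≡* (cong (ℤ._* + 1) (cong₂ ℤ._+_ (sym (ℤ.*-identityʳ i)) (sym (ℤ.*-identityʳ j)))) ⟩
  mkℚᵘ i 0 ℚᵘ.+ mkℚᵘ j 0                      ≈⟨ ℚᵘ.+-cong (ℚ.toℚᵘ-fromℚᵘ (mkℚᵘ i 0)) (ℚ.toℚᵘ-fromℚᵘ (mkℚᵘ j 0)) ⟨
  ℚ.toℚᵘ (fromℤ i) ℚᵘ.+ ℚ.toℚᵘ (fromℤ j)      ≈⟨ ℚ.toℚᵘ-homo-+ (fromℤ i) (fromℤ j) ⟨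
  ℚ.toℚᵘ (fromℤ i ℚ.+ fromℤ j)                ∎)
  where open ℚᵘ.≃-Reasoning

fromℤ-* : ∀ i j → fromℤ (i ℤ.* j) ≡ fromℤ i ℚ.* fromℤ j
fromℤ-* i j = ℚ.toℚᵘ-injective (begin
  ℚ.toℚᵘ (fromℤ (i ℤ.* j))                    ≈⟨ ℚ.toℚᵘ-fromℚᵘ (mkℚᵘ (i ℤ.* j) 0) ⟩
  mkℚᵘ i 0 ℚᵘ.* mkℚᵘ j 0                      ≈⟨ ℚᵘ.*-cong (ℚ.toℚᵘ-fromℚᵘ (mkℚᵘ i 0)) (ℚ.toℚᵘ-fromℚᵘ (mkℚᵘ j 0)) ⟨
  ℚ.toℚᵘ (fromℤ i) ℚᵘ.* ℚ.toℚᵘ (fromℤ j)      ≈⟨ ℚ.toℚᵘ-homo-* (fromℤ i) (fromℤ j) ⟨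
  ℚ.toℚᵘ (fromℤ i ℚ.* fromℤ j)                ∎)
  where open ℚᵘ.≃-Reasoning

-- Turns an integer divisibility into the witness `t ℚ./ n` of a congruence between rationals.
/-minus-fromℤ : ∀ i m p t n .{{_ : NonZero n}} → i ℤ.- m ℤ.* + n ≡ t ℤ.* p →
  i ℚ./ n ℚ.- fromℤ m ≡ fromℤ p ℚ.* (t ℚ./ n)
/-minus-fromℤ i m p t (suc n) i-mn≡tp = ℚ.toℚᵘ-injective (begin
  ℚ.toℚᵘ (i ℚ./ suc n ℚ.- fromℤ m)
    ≈⟨ ℚ.toℚᵘ-homo-+ (i ℚ./ suc n) (ℚ.- fromℤ m) ⟩
  ℚ.toℚᵘ (i ℚ./ suc n) ℚᵘ.+ ℚ.toℚᵘ (ℚ.- fromℤ m)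
    ≈⟨ ℚᵘ.+-cong (ℚ.toℚᵘ-fromℚᵘ (mkℚᵘ i n))
         (ℚᵘ.≃-trans (ℚ.toℚᵘ-homo‿- (fromℤ m)) (ℚᵘ.-‿cong (ℚ.toℚᵘ-fromℚᵘ (mkℚᵘ m 0)))) ⟩
  mkℚᵘ i n ℚᵘ.- mkℚᵘ m 0
    ≈⟨ *≡* crossMultiplied ⟩
  mkℚᵘ p 0 ℚᵘ.* mkℚᵘ t n
    ≈⟨ ℚᵘ.*-cong (ℚ.toℚᵘ-fromℚᵘ (mkℚᵘ p 0)) (ℚ.toℚᵘ-fromℚᵘ (mkℚᵘ t n)) ⟨
  ℚ.toℚᵘ (fromℤ p) ℚᵘ.* ℚ.toℚᵘ (t ℚ./ suc n)
    ≈⟨ ℚ.toℚᵘ-homo-* (fromℤ p) (t ℚ./ suc n) ⟨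
  ℚ.toℚᵘ (fromℤ p ℚ.* (t ℚ./ suc n))
    ∎)
  where
  open ℚᵘ.≃-Reasoning
  N = + suc n

  normalise : ∀ i m N → i ℤ.* + 1 ℤ.+ ℤ.- m ℤ.* N ≡ i ℤ.- m ℤ.* N
  normalise = solveℤ-∀

  crossMultiplied :
    (i ℤ.* + 1 ℤ.+ ℤ.- m ℤ.* N) ℤ.* + (1 * suc n) ≡ p ℤ.* t ℤ.* + (suc n * 1)
  crossMultiplied = cong₂ ℤ._*_
    (trans (normalise i m N) (trans i-mn≡tp (ℤ.*-comm t p)))
    (cong +_ (ℕ.*-comm 1 (suc n)))

-- Rationals and polynomials integral at p.

∣-coprime : ∀ {d n p} → d ∣ n → Coprime n p → Coprime d p
∣-coprime d∣n n⊥p (e∣d , e∣p) = n⊥p (∣-trans e∣d d∣n , e∣p)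

-- A common divisor of mn and p is coprime to m because it divides p, hence divides n by Euclid's
-- lemma.
*-coprime : ∀ {m n p} → Coprime m p → Coprime n p → Coprime (m * n) p
*-coprime m⊥p n⊥p (d∣mn , d∣p) = n⊥p (coprime-divisor d⊥m d∣mn , d∣p)
  where
  d⊥m : Coprime _ _
  d⊥m (e∣d , e∣m) = m⊥p (e∣m , ∣-trans e∣d d∣p)

^-coprime : ∀ {m p} → Coprime m p → ∀ k → Coprime (m ^ k) p
^-coprime m⊥p zero    = Coprime.1-coprimeTo _
^-coprime m⊥p (suc k) = *-coprime m⊥p (^-coprime m⊥p k)

-- Stated over ℤ because the library describes the denominators of sums,
-- products and quotients that way.
↧*≡⇒∣ : ∀ q g n → ℚ.↧ q ℤ.* g ≡ + n → ↧ₙ q ∣ n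
↧*≡⇒∣ q g n eq = divides ℤ.∣ g ∣ (begin
  n                        ≡⟨ cong ℤ.∣_∣ eq ⟨
  ℤ.∣ ℚ.↧ q ℤ.* g ∣        ≡⟨ ℤ.abs-* (ℚ.↧ q) g ⟩
  ↧ₙ q * ℤ.∣ g ∣           ≡⟨ ℕ.*-comm (↧ₙ q) ℤ.∣ g ∣ ⟩
  ℤ.∣ g ∣ * ↧ₙ q           ∎)
  where open ≡-Reasoning

module _ (p : ℕ) where

  -- The ideal generated by p in the localisation of ℤ that `Integral p` describes.
  Multiple : ℚ → Set
  Multiple q = Σ[ s ∈ ℚ ] (Integral p s × q ≡ fromℤ (+ p) ℚ.* s)

  integral-/ : ∀ i n .{{_ : NonZero n}} → Coprime n p → Integral p (i ℚ./ n)
  integral-/ i n n⊥p = ∣-coprime (↧*≡⇒∣ (i ℚ./ n) _ n (ℚ.↧-/ i n)) n⊥p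

  integral-fromℤ : ∀ i → Integral p (fromℤ i)
  integral-fromℤ i = integral-/ i 1 (Coprime.1-coprimeTo p)

  -- The reduced denominator of a sum divides the product of the denominators.
  integral-+ : ∀ q r → Integral p q → Integral p r → Integral p (q ℚ.+ r)
  integral-+ q r q-int r-int = ∣-coprime
    (↧*≡⇒∣ (q ℚ.+ r) _ (↧ₙ q * ↧ₙ r) (ℚ.↧-+ q r)) (*-coprime q-int r-int)

  integral-* : ∀ q r → Integral p q → Integral p r → Integral p (q ℚ.* r)
  integral-* q r q-int r-int = ∣-coprime
    (↧*≡⇒∣ (q ℚ.* r) _ (↧ₙ q * ↧ₙ r) (ℚ.↧-* q r)) (*-coprime q-int r-int)

  integral-neg : ∀ q → Integral p q → Integral p (ℚ.- q)
  integral-neg q = subst (λ d → Coprime d p) (cong ℤ.∣_∣ (sym (ℚ.↧-neg q)))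

  multiple⇒integral : ∀ q → Multiple q → Integral p q
  multiple⇒integral q (s , s-int , q≡ps) =
    subst (Integral p) (sym q≡ps) (integral-* (fromℤ (+ p)) s (integral-fromℤ (+ p)) s-int)

  multiple-0 : Multiple 0ℚ
  multiple-0 = 0ℚ , integral-fromℤ (+ 0) , sym (ℚ.*-zeroʳ (fromℤ (+ p)))

  multiple-+ : ∀ q r → Multiple q → Multiple r → Multiple (q ℚ.+ r)
  multiple-+ q r (s , s-int , q≡ps) (t , t-int , r≡pt) =
    s ℚ.+ t , integral-+ s t s-int t-int ,
    trans (cong₂ ℚ._+_ q≡ps r≡pt) (sym (ℚ.*-distribˡ-+ (fromℤ (+ p)) s t))

  multiple-* : ∀ q r → Multiple q → Integral p r → Multiple (q ℚ.* r)
  multiple-* q r (s , s-int , q≡ps) r-int =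
    s ℚ.* r , integral-* s r s-int r-int ,
    trans (cong (ℚ._* r) q≡ps) (ℚ.*-assoc (fromℤ (+ p)) s r)

  Integralᴾ : Poly → Set
  Integralᴾ f = ∀ n → Integral p (coeff f n)

  Multipleᴾ : Poly → Set
  Multipleᴾ f = ∀ n → Multiple (coeff f n)

  integral-0 : Integral p 0ℚ
  integral-0 = integral-fromℤ (+ 0)

  integralᴾ-∷ : ∀ a f → Integral p a → Integralᴾ f → Integralᴾ (a ∷ f)
  integralᴾ-∷ a f a-int f-int zero    = a-int
  integralᴾ-∷ a f a-int f-int (suc n) = f-int n

  integralᴾ-+ : ∀ f g → Integralᴾ f → Integralᴾ g → Integralᴾ (f +ᴾ g)
  integralᴾ-+ f g f-int g-int n = subst (Integral p) (sym (coeff-+ f g n))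
    (integral-+ (coeff f n) (coeff g n) (f-int n) (g-int n))

  integralᴾ-neg : ∀ f → Integralᴾ f → Integralᴾ (-ᴾ f)
  integralᴾ-neg f f-int n = subst (Integral p) (sym (coeff-neg f n))
    (integral-neg (coeff f n) (f-int n))

  integralᴾ-* : ∀ f g → Integralᴾ f → Integralᴾ g → Integralᴾ (f *ᴾ g)
  integralᴾ-* []      g f-int g-int n = integral-0
  integralᴾ-* (a ∷ f) g f-int g-int n = subst (Integral p) (sym (coeff-∷-* a f g n))
    (integral-+ (a ℚ.* coeff g n) (coeff (0ℚ ∷ (f *ᴾ g)) n)
      (integral-* a (coeff g n) (f-int 0) (g-int n))
      (integralᴾ-∷ 0ℚ (f *ᴾ g) integral-0 (integralᴾ-* f g (λ m → f-int (suc m)) g-int) n))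

  integralᴾ-0 : Integralᴾ 0ᴾ
  integralᴾ-0 n = integral-0

  integralᴾ-1 : Integralᴾ 1ᴾ
  integralᴾ-1 = integralᴾ-∷ 1ℚ 0ᴾ (integral-fromℤ (+ 1)) integralᴾ-0

  integralᴾ-X : Integralᴾ X
  integralᴾ-X = integralᴾ-∷ 0ℚ 1ᴾ integral-0 integralᴾ-1

  integralᴾ-^ : ∀ f k → Integralᴾ f → Integralᴾ (f ^ᴾ k)
  integralᴾ-^ f zero    f-int = integralᴾ-1
  integralᴾ-^ f (suc k) f-int = integralᴾ-* f (f ^ᴾ k) f-int (integralᴾ-^ f k f-int)

  multipleᴾ-C-* : ∀ a f → Multiple a → Integralᴾ f → Multipleᴾ (C a *ᴾ f)
  multipleᴾ-C-* a f a-mult f-int n = subst Multiple (sym (coeff-C-* a f n))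
    (multiple-* a (coeff f n) a-mult (f-int n))

  multipleᴾ-+ : ∀ f g → Multipleᴾ f → Multipleᴾ g → Multipleᴾ (f +ᴾ g)
  multipleᴾ-+ f g f-mult g-mult n = subst Multiple (sym (coeff-+ f g n))
    (multiple-+ (coeff f n) (coeff g n) (f-mult n) (g-mult n))

  -- The bound k ≤ n is passed to the terms because the defects are known to be divisible by p only
  -- in that range.
  multipleᴾ-∑ : ∀ n (f : ℕ → Poly) → (∀ k → k ≤ n → Multipleᴾ (f k)) → Multipleᴾ (∑≤ n f)
  multipleᴾ-∑ zero    f f-mult =
    multipleᴾ-+ (f 0) 0ᴾ (f-mult 0 z≤n) (λ n → multiple-0)
  multipleᴾ-∑ (suc n) f f-mult =
    multipleᴾ-+ (f 0) (∑≤ n (λ k → f (suc k))) (f-mult 0 z≤n)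
      (multipleᴾ-∑ n (λ k → f (suc k)) (λ k k≤n → f-mult (suc k) (s≤s k≤n)))

  multipleᴾ⇒≡0 : ∀ f → Multipleᴾ f → f ≡ 0ᴾ [modᴾ p ]
  multipleᴾ⇒≡0 f f-mult n with f-mult n
  ... | s , s-int , fₙ≡ps =
    multiple⇒integral (coeff f n) (f-mult n) , integral-0 ,
    s , s-int , trans (ℚ.+-identityʳ (coeff f n)) fₙ≡ps

-- The Legendre identity inside ℚ[x].

private
  module Polyᴿ = CommutativeRing polyCommutativeRing
open Mult Polyᴿ.semiring using (×-assocˡ) renaming (_×_ to _·_)
open ShiftedLegendre polyCommutativeRing
  using (legendreCoeff; sum≤; sum≤-+; sum≤-cong; sum≤-legendre-difference)

C-* : ∀ a b → C (a ℚ.* b) ≈ᴾ C a *ᴾ C b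
C-* a b zero    = sym (ℚ.+-identityʳ (a ℚ.* b))
C-* a b (suc n) = refl

C-fromℤ-+ : ∀ b → C (fromℤ (+ b)) ≈ᴾ b · 1ᴾ
-- `C 0ℚ` is a list with one entry and `0 · 1ᴾ` is empty, so they agree only coefficientwise.
C-fromℤ-+ zero    zero    = refl
C-fromℤ-+ zero    (suc n) = refl
C-fromℤ-+ (suc b) n = begin
  coeff (C (fromℤ (+ suc b))) n                  ≡⟨ cong (λ q → coeff (C q) n) (fromℤ-+ (+ 1) (+ b)) ⟩
  coeff (1ᴾ +ᴾ C (fromℤ (+ b))) n                ≡⟨ +ᴾ-cong {1ᴾ} {1ᴾ} {C (fromℤ (+ b))} {b · 1ᴾ} (λ _ → refl) (C-fromℤ-+ b) n ⟩
  coeff (1ᴾ +ᴾ b · 1ᴾ) n         ∎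
  where open ≡-Reasoning

C-fromℤ-* : ∀ i j → C (fromℤ (i ℤ.* j)) ≈ᴾ C (fromℤ i) *ᴾ C (fromℤ j)
C-fromℤ-* i j n = trans (cong (λ q → coeff (C q) n) (fromℤ-* i j)) (C-* (fromℤ i) (fromℤ j) n)

C-fromℤ-[-1]^ : ∀ k → C (fromℤ (-1ℤ ℤ.^ k)) ≈ᴾ (-ᴾ 1ᴾ) ^ᴾ k
C-fromℤ-[-1]^ zero    n = refl
C-fromℤ-[-1]^ (suc k) n = trans (C-fromℤ-* -1ℤ (-1ℤ ℤ.^ k) n)
  (*ᴾ-congˡ (-ᴾ 1ᴾ) (C (fromℤ (-1ℤ ℤ.^ k))) ((-ᴾ 1ᴾ) ^ᴾ k) (C-fromℤ-[-1]^ k) n)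

-- Joins the two guises of one number: the integer of the divisibility argument and the multiple of
-- 1 in the ring identity.
C-signedCoeff : ∀ n k → C (fromℤ (signedCoeff n k)) ≈ᴾ legendreCoeff n k
C-signedCoeff n k = begin
  C (fromℤ (signedCoeff n k))
    ≈⟨ C-fromℤ-* (-1ℤ ℤ.^ k) (+ absCoeff n k) ⟩
  C (fromℤ (-1ℤ ℤ.^ k)) *ᴾ C (fromℤ (+ absCoeff n k))
    ≈⟨ *ᴾ-cong {C (fromℤ (-1ℤ ℤ.^ k))} {σ} {C (fromℤ (+ absCoeff n k))} {absCoeff n k · 1ᴾ}
         (C-fromℤ-[-1]^ k) (C-fromℤ-+ (absCoeff n k)) ⟩
  σ *ᴾ (absCoeff n k · 1ᴾ)
    ≈⟨ *ᴾ-congˡ σ ((n choose k) · (((k + n) choose n) · 1ᴾ)) (absCoeff n k · 1ᴾ)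
         (×-assocˡ 1ᴾ (n choose k) ((k + n) choose n)) ⟨
  legendreCoeff n k
    ∎
  where
  open SetoidReasoning Polyᴿ.setoid
  σ = (-ᴾ 1ᴾ) ^ᴾ k

*ᴾ-difference : ∀ a b f → C a *ᴾ f ≈ᴾ C (a ℚ.- b) *ᴾ f +ᴾ C b *ᴾ f
*ᴾ-difference a b f n = begin
  coeff (C a *ᴾ f) n
    ≡⟨ coeff-C-* a f n ⟩
  a ℚ.* coeff f n
    ≡⟨ solveℚ 3 (λ a b x → a :* x := (a :- b) :* x :+ b :* x) refl a b (coeff f n) ⟩
  (a ℚ.- b) ℚ.* coeff f n ℚ.+ b ℚ.* coeff f n
    ≡⟨ cong₂ ℚ._+_ (coeff-C-* (a ℚ.- b) f n) (coeff-C-* b f n) ⟨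
  coeff (C (a ℚ.- b) *ᴾ f) n ℚ.+ coeff (C b *ᴾ f) n
    ≡⟨ coeff-+ (C (a ℚ.- b) *ᴾ f) (C b *ᴾ f) n ⟨
  coeff (C (a ℚ.- b) *ᴾ f +ᴾ C b *ᴾ f) n
    ∎
  where open ≡-Reasoning

-- Since the sum with coefficients `b k` is exactly zero, each `a k` may be replaced by
-- `a k ℚ.- b k`, which for `w k` and its Legendre counterpart is a multiple of p.
∑-difference : ∀ n (a b : ℕ → ℚ) (f : ℕ → Poly) → ∑[ k ≤ n ] (C (b k) *ᴾ f k) ≈ᴾ 0ᴾ →
  ∑[ k ≤ n ] (C (a k) *ᴾ f k) ≈ᴾ ∑[ k ≤ n ] (C (a k ℚ.- b k) *ᴾ f k)
∑-difference n a b f ∑b≈0 = begin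
  ∑[ k ≤ n ] (C (a k) *ᴾ f k)
    ≈⟨ sum≤-cong n {λ k → C (a k) *ᴾ f k} {λ k → C (a k ℚ.- b k) *ᴾ f k +ᴾ C (b k) *ᴾ f k}
         (λ k → *ᴾ-difference (a k) (b k) (f k)) ⟩
  ∑[ k ≤ n ] (C (a k ℚ.- b k) *ᴾ f k +ᴾ C (b k) *ᴾ f k)
    ≈⟨ sum≤-+ n (λ k → C (a k ℚ.- b k) *ᴾ f k) (λ k → C (b k) *ᴾ f k) ⟩
  ∑a-b +ᴾ ∑[ k ≤ n ] (C (b k) *ᴾ f k)
    ≈⟨ +ᴾ-cong {∑a-b} {∑a-b} {∑[ k ≤ n ] (C (b k) *ᴾ f k)} {0ᴾ} (λ _ → refl) ∑b≈0 ⟩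
  ∑a-b +ᴾ 0ᴾ
    ≈⟨ +ᴾ-identityʳ ∑a-b ⟩
  ∑a-b
    ∎
  where
  open SetoidReasoning Polyᴿ.setoid
  ∑a-b = ∑[ k ≤ n ] (C (a k ℚ.- b k) *ᴾ f k)

legendreDifference : ℕ → ℕ → Poly
legendreDifference n k = X ^ᴾ k -ᴾ (-ᴾ 1ᴾ) ^ᴾ n *ᴾ (1ᴾ -ᴾ X) ^ᴾ k

integralᴾ-legendreDifference : ∀ p n k → Integralᴾ p (legendreDifference n k)
integralᴾ-legendreDifference p n k =
  integralᴾ-+ p (X ^ᴾ k) (-ᴾ (σ *ᴾ (1ᴾ -ᴾ X) ^ᴾ k))
    (integralᴾ-^ p X k (integralᴾ-X p))
    (integralᴾ-neg p (σ *ᴾ (1ᴾ -ᴾ X) ^ᴾ k)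
      (integralᴾ-* p σ ((1ᴾ -ᴾ X) ^ᴾ k)
        (integralᴾ-^ p (-ᴾ 1ᴾ) n (integralᴾ-neg p 1ᴾ (integralᴾ-1 p)))
        (integralᴾ-^ p (1ᴾ -ᴾ X) k
          (integralᴾ-+ p 1ᴾ (-ᴾ X) (integralᴾ-1 p) (integralᴾ-neg p X (integralᴾ-X p))))))
  where σ = (-ᴾ 1ᴾ) ^ᴾ n

-- The reflection identity, taken in the ring ℚ[x] at its own element `X`.
∑-signedCoeff : ∀ n → ∑[ k ≤ n ] (C (fromℤ (signedCoeff n k)) *ᴾ legendreDifference n k) ≈ᴾ 0ᴾ
∑-signedCoeff n = begin
  ∑[ k ≤ n ] (C (fromℤ (signedCoeff n k)) *ᴾ legendreDifference n k)
    ≈⟨ sum≤-cong n {λ k → C (fromℤ (signedCoeff n k)) *ᴾ legendreDifference n k}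
         {λ k → legendreCoeff n k *ᴾ legendreDifference n k}
         (λ k → *ᴾ-cong {C (fromℤ (signedCoeff n k))} {legendreCoeff n k} {legendreDifference n k}
           (C-signedCoeff n k) (λ _ → refl)) ⟩
  ∑[ k ≤ n ] (legendreCoeff n k *ᴾ legendreDifference n k)
    ≈⟨ sum≤-legendre-difference n X ⟩
  0ᴾ
    ∎
  where open SetoidReasoning Polyᴿ.setoid

-- Specialisation to a prime p > 3 and n = [p/3].

!-coprime : ∀ {p} → Prime p → ∀ k → k < p → Coprime (k !) p
!-coprime p-prime zero    _     = Coprime.1-coprimeTo _
!-coprime p-prime (suc k) 1+k<p = *-coprime
  (Coprime.sym (prime⇒coprime p-prime 1+k<p))
  (!-coprime p-prime k (ℕ.<-trans (ℕ.n<1+n k) 1+k<p))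

module _ {p : ℕ} (p-prime : Prime p) (3<p : 3 < p) where

  private
    n = p / 3

    3-coprime : Coprime 3 p
    3-coprime = Coprime.sym (prime⇒coprime p-prime 3<p)

  denom-coprime : ∀ k → k < p → Coprime (denom k) p
  denom-coprime k k<p = *-coprime
    -- 27 is taken as 3 cubed.
    (^-coprime (^-coprime 3-coprime 3) k)
    (^-coprime (!-coprime p-prime k k<p) 3)

  -- As 3 does not divide p, one of the two factors is p itself.
  p∣[1+3[p/3]][2+3[p/3]] : + p ℤ.∣ (+ 1 ℤ.+ + 3 ℤ.* + n) ℤ.* (+ 2 ℤ.+ + 3 ℤ.* + n)
  p∣[1+3[p/3]][2+3[p/3]] = byRemainder (p % 3) (m%n<n p 3) (m≡m%n+[m/n]*n p 3)
    where
    pos : ∀ r → p ≡ r + n * 3 → + p ≡ + r ℤ.+ + 3 ℤ.* + n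
    pos r p≡ = trans (cong +_ p≡) (cong (λ z → + r ℤ.+ z)
      (trans (ℤ.pos-* n 3) (ℤ.*-comm (+ n) (+ 3))))

    byRemainder : ∀ r → r < 3 → p ≡ r + n * 3 →
      + p ℤ.∣ (+ 1 ℤ.+ + 3 ℤ.* + n) ℤ.* (+ 2 ℤ.+ + 3 ℤ.* + n)
    -- Remainder 0 would make 3 a common divisor of 3 and p.
    byRemainder 0 _ p≡ = contradiction (3-coprime (∣-refl , divides n p≡)) λ ()
    byRemainder 1 _ p≡ = ℤ.∣m⇒∣m*n (+ 2 ℤ.+ + 3 ℤ.* + n) (ℤ.∣-reflexive (pos 1 p≡))
    byRemainder 2 _ p≡ = ℤ.∣n⇒∣m*n (+ 1 ℤ.+ + 3 ℤ.* + n) (ℤ.∣-reflexive (pos 2 p≡))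
    byRemainder (suc (suc (suc _))) (s≤s (s≤s (s≤s ()))) _

  k≤p/3⇒k<p : ∀ {k} → k ≤ n → k < p
  k≤p/3⇒k<p k≤n = ℕ.≤-<-trans k≤n
    (m/n<m p 3 {{ℕ.>-nonZero (ℕ.<-trans (s≤s z≤n) 3<p)}} (s≤s (s≤s z≤n)))

  -- The witness is the quotient of the defect by p, over `denom k`, which is prime to p since k ≤
  -- p/3 < p.
  multiple-w-signedCoeff : ∀ k → k ≤ n → Multiple p (w k ℚ.- fromℤ (signedCoeff n k))
  multiple-w-signedCoeff k k≤n with ∣-signedDefect p∣[1+3[p/3]][2+3[p/3]] k k≤n
  ... | ℤ.divides t defect≡tp =
    t ℚ./ denom k , integral-/ p t (denom k) (denom-coprime k (k≤p/3⇒k<p k≤n)) ,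
    /-minus-fromℤ (+ ((3 * k) !)) (signedCoeff n k) (+ p) t (denom k) defect≡tp
    where
    instance
      denom≢0 : NonZero (denom k)
      denom≢0 = ℕ.m*n≢0 (27 ^ k) ((k !) ^ 3) {{ℕ.m^n≢0 27 k}} {{ℕ.m^n≢0 (k !) 3 {{k ℕ.!≢0}}}}

theorem2p4 : ∀ (p : ℕ) → Prime p → 3 < p →
    ∑[ k ≤ p / 3 ] (C (w k) *ᴾ (X ^ᴾ k -ᴾ (-ᴾ 1ᴾ) ^ᴾ (p / 3) *ᴾ (1ᴾ -ᴾ X) ^ᴾ k)) ≡ 0ᴾ [modᴾ p ]
theorem2p4 p p-prime 3<p = multipleᴾ⇒≡0 p (∑[ k ≤ n ] (C (w k) *ᴾ g k)) λ m →
  subst (Multiple p) (sym (∑-difference n w v g (∑-signedCoeff n) m))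
    (multipleᴾ-∑ p n (λ k → C (w k ℚ.- v k) *ᴾ g k)
      (λ k k≤n → multipleᴾ-C-* p (w k ℚ.- v k) (g k)
        (multiple-w-signedCoeff p-prime 3<p k k≤n) (integralᴾ-legendreDifference p n k)) m)
  where
  n = p / 3
  v = λ k → fromℤ (signedCoeff n k)
  g = legendreDifference n
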